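{- The following varieties are explosive, i.e. every algebra $\mathbf{A}$ in any one of them satisfies $a\wedge\neg a=0$ for all $a\in A$: 1. $\mathsf{BI}(\mathrm{cl},\mathrm{ca}_\to)$; 2. $\mathsf{BI}(\mathrm{ciw},\mathrm{ca}_\to)$; 3. $\mathsf{BI}(\mathrm{ci},\mathrm{ca}_\to)$; 4. $\mathsf{BI}(i1,\mathrm{ca}_\to)$.
   Context: A BALFI (Boolean algebra with LFI operators) is an algebra $\mathbf{B}=\langle B,\wedge,\vee,\to,\neg,\circ,0,1\rangle$, with unary operations $\neg,\circ$, such that $\langle B,\wedge,\vee,\to,0,1\rangle$ is a Boolean algebra and, for every $a\in B$, $a\vee\neg a=1$ and $a\wedge\neg a\wedge\circ a=0$. The Boolean complement is denoted ${\sim}a$ (in general $\neg a\neq{\sim}a$). $\mathsf{BI}(Ax_1,Ax_2)$ is the class of all BALFIs satisfying, for all elements $a,b$, the equations corresponding to $Ax_1$ and $Ax_2$, where: - $(\mathrm{cl})$: $\circ a=\neg(a\wedge\neg a)$; - $(\mathrm{ciw})$: $\circ a={\sim}(a\wedge\neg a)$; - $(\mathrm{ci})$: $\neg(\circ a)=a\wedge\neg a$; - $(i1)$: $\neg(\circ a)\wedge a=\neg(\circ a)$; - $(\mathrm{ca}_\to)$: $(\circ a\wedge\circ b)\wedge\circ(a\to b)=\circ a\wedge\circ b$. -}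

module Defs where

open import Algebra.Core using (Op₁; Op₂)
open import Algebra.Definitions using (Congruent₁)
open import Algebra.Lattice.Bundles using (BooleanAlgebra)
open import Level using (Level; _⊔_; suc)
open import Relation.Unary using (Pred; _∈_; _∩_)

-- Equality is the setoid equality _≈_ of the underlying Boolean algebra, so
-- the operations ¬ and ∘ come with congruence laws.  The library's Boolean
-- algebras have the complement, here written ∼, as a primitive and no
-- implication.  Implication is part of the signature of a BALFI, hence a field
-- of its own, with the law that makes it the Boolean implication.
record BALFI (c ℓ : Level) : Set (suc (c ⊔ ℓ)) where
  infixr 8 ¬_ ∘_
  infixr 5 _⇒_
  field
    booleanAlgebra : BooleanAlgebra c ℓ

  open BooleanAlgebra booleanAlgebra public
    renaming (¬_ to infixr 8 ∼_; ¬-cong to ∼-cong; ⊤ to 1#; ⊥ to 0#)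

  field
    _⇒_             : Op₂ Carrier
    ¬_              : Op₁ Carrier
    ∘_              : Op₁ Carrier
    ¬-cong          : Congruent₁ _≈_ ¬_
    ∘-cong          : Congruent₁ _≈_ ∘_
    ⇒-∼-∨           : ∀ a b → a ⇒ b ≈ ∼ a ∨ b
    excludedMiddle  : ∀ a → a ∨ ¬ a ≈ 1#
    gentleExplosion : ∀ a → a ∧ ¬ a ∧ ∘ a ≈ 0#

module _ {c ℓ : Level} where

  cl : Pred (BALFI c ℓ) (c ⊔ ℓ)
  cl A = ∀ a → ∘ a ≈ ¬ (a ∧ ¬ a)
    where open BALFI A

  ciw : Pred (BALFI c ℓ) (c ⊔ ℓ)
  ciw A = ∀ a → ∘ a ≈ ∼ (a ∧ ¬ a)
    where open BALFI A

  ci : Pred (BALFI c ℓ) (c ⊔ ℓ)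
  ci A = ∀ a → ¬ (∘ a) ≈ a ∧ ¬ a
    where open BALFI A

  i1 : Pred (BALFI c ℓ) (c ⊔ ℓ)
  i1 A = ∀ a → ¬ (∘ a) ∧ a ≈ ¬ (∘ a)
    where open BALFI A

  ca⇒ : Pred (BALFI c ℓ) (c ⊔ ℓ)
  ca⇒ A = ∀ a b → (∘ a ∧ ∘ b) ∧ ∘ (a ⇒ b) ≈ ∘ a ∧ ∘ b
    where open BALFI A

  BI : (Ax₁ Ax₂ : Pred (BALFI c ℓ) (c ⊔ ℓ)) → Pred (BALFI c ℓ) (c ⊔ ℓ)
  BI Ax₁ Ax₂ = Ax₁ ∩ Ax₂

  Explosive : Pred (BALFI c ℓ) (c ⊔ ℓ) → Set (suc (c ⊔ ℓ))
  Explosive K = ∀ (A : BALFI c ℓ) → A ∈ K →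
    let open BALFI A in ∀ a → a ∧ ¬ a ≈ 0#

{-# OPTIONS --safe #-}
-- Each of cl, ciw, ci and i1 yields a ∨ ∘ a ≈ 1, that is ∼ ∘ a ≤ a; in
-- particular ∘ 0 ≈ 1.  Since a is ∼ a ⇒ 0, the law ca⇒ then gives
-- ∘ ∼ a ≤ ∘ a.  But a ≤ ∘ ∼ a, because ∼ a ∨ ∘ ∼ a ≈ 1, so a ≤ ∘ a and gentle
-- explosion makes a ∧ ¬ a vanish.
module Submission where

open import Defs
open import Level using (Level)
open import Data.Product using (_×_; _,_)
import Algebra.Lattice.Properties.BooleanAlgebra as BooleanAlgebraProperties
import Relation.Binary.Reasoning.Setoid as SetoidReasoning

module _ {c ℓ : Level} (A : BALFI c ℓ) where

  open BALFI A
  open BooleanAlgebraProperties booleanAlgebra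
  open SetoidReasoning setoid

  -- The order is encoded by `x ∧ y ≈ x`. By absorption `y` equals `y ∨ x`, so the join with `z`
  -- already contains `x ∨ z`.
  ∨-≈1-monoˡ : ∀ {x y z} → x ∧ y ≈ x → x ∨ z ≈ 1# → y ∨ z ≈ 1#
  ∨-≈1-monoˡ {x} {y} {z} x≤y x∨z≈1 = begin
    y ∨ z            ≈⟨ ∨-congʳ (∨-absorbs-∧ y x) ⟨
    (y ∨ y ∧ x) ∨ z  ≈⟨ ∨-congʳ (∨-congˡ (trans (∧-comm y x) x≤y)) ⟩
    (y ∨ x) ∨ z      ≈⟨ ∨-assoc y x z ⟩
    y ∨ (x ∨ z)      ≈⟨ ∨-congˡ x∨z≈1 ⟩
    y ∨ 1#           ≈⟨ ∨-zeroʳ y ⟩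
    1#               ∎

  -- Meeting the hypothesis with `x` leaves only `x ∧ y`, since `x ∧ ∼ x` vanishes.
  ∼x∨y≈1⇒x≤y : ∀ {x y} → ∼ x ∨ y ≈ 1# → x ∧ y ≈ x
  ∼x∨y≈1⇒x≤y {x} {y} ∼x∨y≈1 = begin
    x ∧ y              ≈⟨ ∨-identityˡ (x ∧ y) ⟨
    0# ∨ x ∧ y         ≈⟨ ∨-congʳ (∧-complementʳ x) ⟨
    x ∧ ∼ x ∨ x ∧ y    ≈⟨ ∧-distribˡ-∨ x (∼ x) y ⟨
    x ∧ (∼ x ∨ y)      ≈⟨ ∧-congˡ ∼x∨y≈1 ⟩
    x ∧ 1#             ≈⟨ ∧-identityʳ x ⟩
    x                  ∎

  a∧¬a≤a : ∀ a → (a ∧ ¬ a) ∧ a ≈ a ∧ ¬ a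
  a∧¬a≤a a = begin
    (a ∧ ¬ a) ∧ a  ≈⟨ ∧-comm (a ∧ ¬ a) a ⟩
    a ∧ (a ∧ ¬ a)  ≈⟨ ∧-assoc a a (¬ a) ⟨
    (a ∧ a) ∧ ¬ a  ≈⟨ ∧-congʳ (∧-idem a) ⟩
    a ∧ ¬ a        ∎

  -- Excluded middle at `a ∧ ¬ a` has `∘ a` as its second disjunct by `cl`; the first is then
  -- enlarged to `a`.
  cl⇒a∨∘a≈1 : cl A → ∀ a → a ∨ ∘ a ≈ 1#
  cl⇒a∨∘a≈1 isCl a = ∨-≈1-monoˡ (a∧¬a≤a a)
    (trans (∨-congˡ (isCl a)) (excludedMiddle (a ∧ ¬ a)))

  ciw⇒a∨∘a≈1 : ciw A → ∀ a → a ∨ ∘ a ≈ 1#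
  ciw⇒a∨∘a≈1 isCiw a = ∨-≈1-monoˡ (a∧¬a≤a a)
    (trans (∨-congˡ (isCiw a)) (∨-complementʳ (a ∧ ¬ a)))

  -- Here excluded middle is taken at `∘ a`: `i1` places `¬ ∘ a` below `a`.
  i1⇒a∨∘a≈1 : i1 A → ∀ a → a ∨ ∘ a ≈ 1#
  i1⇒a∨∘a≈1 isI1 a = ∨-≈1-monoˡ (isI1 a)
    (trans (∨-comm (¬ ∘ a) (∘ a)) (excludedMiddle (∘ a)))

  ci⇒i1 : ci A → i1 A
  ci⇒i1 isCi a = begin
    ¬ ∘ a ∧ a      ≈⟨ ∧-congʳ (isCi a) ⟩
    (a ∧ ¬ a) ∧ a  ≈⟨ a∧¬a≤a a ⟩
    a ∧ ¬ a        ≈⟨ isCi a ⟨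
    ¬ ∘ a          ∎

  module _ (a∨∘a≈1 : ∀ a → a ∨ ∘ a ≈ 1#) (isCa⇒ : ca⇒ A) where

    ∘0≈1 : ∘ 0# ≈ 1#
    ∘0≈1 = trans (sym (∨-identityˡ (∘ 0#))) (a∨∘a≈1 0#)

    ∼a⇒0≈a : ∀ a → ∼ a ⇒ 0# ≈ a
    ∼a⇒0≈a a = begin
      ∼ a ⇒ 0#    ≈⟨ ⇒-∼-∨ (∼ a) 0# ⟩
      ∼ ∼ a ∨ 0#  ≈⟨ ∨-identityʳ (∼ ∼ a) ⟩
      ∼ ∼ a       ≈⟨ ¬-involutive a ⟩
      a           ∎

    ∘∼a≤∘a : ∀ a → ∘ ∼ a ∧ ∘ a ≈ ∘ ∼ a
    ∘∼a≤∘a a = begin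
      -- Both factors are expanded to match the left side of `ca⇒` at `∼ a` and `0#`; the extra
      -- `∘ 0#` is harmless, being `1#`.
      ∘ ∼ a ∧ ∘ a                   ≈⟨ ∧-cong ∘∼a∧∘0≈∘∼a (∘-cong (∼a⇒0≈a a)) ⟨
      (∘ ∼ a ∧ ∘ 0#) ∧ ∘ (∼ a ⇒ 0#) ≈⟨ isCa⇒ (∼ a) 0# ⟩
      ∘ ∼ a ∧ ∘ 0#                  ≈⟨ ∘∼a∧∘0≈∘∼a ⟩
      ∘ ∼ a                         ∎
      where
      ∘∼a∧∘0≈∘∼a : ∘ ∼ a ∧ ∘ 0# ≈ ∘ ∼ a
      ∘∼a∧∘0≈∘∼a = trans (∧-congˡ ∘0≈1) (∧-identityʳ (∘ ∼ a))

    a≤∘a : ∀ a → a ∧ ∘ a ≈ a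
    a≤∘a a = ∼x∨y≈1⇒x≤y (begin
      ∼ a ∨ ∘ a    ≈⟨ ∨-comm (∼ a) (∘ a) ⟩
      -- The hypothesis at `∼ a` makes `∘ ∼ a ∨ ∼ a` the top, and `∘ ∼ a` may be enlarged to `∘ a`.
      ∘ a ∨ ∼ a    ≈⟨ ∨-≈1-monoˡ (∘∼a≤∘a a)
                        (trans (∨-comm (∘ ∼ a) (∼ a)) (a∨∘a≈1 (∼ a))) ⟩
      1#           ∎)

    a∧¬a≈0 : ∀ a → a ∧ ¬ a ≈ 0#
    a∧¬a≈0 a = begin
      a ∧ ¬ a          ≈⟨ ∧-comm a (¬ a) ⟩
      -- Replacing `a` by `a ∧ ∘ a` supplies the factor `∘ a` that gentle explosion requires.
      ¬ a ∧ a          ≈⟨ ∧-congˡ (a≤∘a a) ⟨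
      ¬ a ∧ (a ∧ ∘ a)  ≈⟨ ∧-assoc (¬ a) a (∘ a) ⟨
      (¬ a ∧ a) ∧ ∘ a  ≈⟨ ∧-congʳ (∧-comm (¬ a) a) ⟩
      (a ∧ ¬ a) ∧ ∘ a  ≈⟨ ∧-assoc a (¬ a) (∘ a) ⟩
      a ∧ ¬ a ∧ ∘ a    ≈⟨ gentleExplosion a ⟩
      0#               ∎

corollary3p16 : ∀ {c ℓ : Level} →
    Explosive {c} {ℓ} (BI cl ca⇒) ×
    Explosive {c} {ℓ} (BI ciw ca⇒) ×
    Explosive {c} {ℓ} (BI ci ca⇒) ×
    Explosive {c} {ℓ} (BI i1 ca⇒)
corollary3p16 =
  (λ A (isCl , isCa⇒) → a∧¬a≈0 A (cl⇒a∨∘a≈1 A isCl) isCa⇒) ,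
  (λ A (isCiw , isCa⇒) → a∧¬a≈0 A (ciw⇒a∨∘a≈1 A isCiw) isCa⇒) ,
  (λ A (isCi , isCa⇒) → a∧¬a≈0 A (i1⇒a∨∘a≈1 A (ci⇒i1 A isCi)) isCa⇒) ,
  (λ A (isI1 , isCa⇒) → a∧¬a≈0 A (i1⇒a∨∘a≈1 A isI1) isCa⇒)
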